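{- Let $n\ge2$, let $H=(h_1>\cdots>h_p=1)$ be a decreasing gap sequence, and fix $2\le j\le p$ and $L,B\ge1$. Suppose there is an integer $a\in Q_j$ with $a\ge2$ such that $ah_j$ has a nonnegative representation using at most $L$ earlier gaps, each no larger than $Bh_j$. Suppose also that for every residue $r\in\{0,\dots,a-1\}$ there is a multiplier $w_r\in Q_j$ with $w_r\equiv r\pmod a$ such that $w_rh_j$ has a nonnegative representation using at most $L$ earlier gaps, each no larger than $Bh_j$; take $w_0=0$. Then $Q_j$ is a numerical semigroup and $$\operatorname{cond}(Q_j)\le LB,\qquad g_j^{(n)}\le g(Q_j)<LB.$$ Moreover, $$\lambda_j(H)\le\min\left\{2LB-1,\ L\left(1+\frac{LB}{a}\right)\right\},$$ and hence, for every $1\le k<n$, $$\lVert kh_j/n\rVert_{\mathbb T}\le\min\left\{2LB-1,\ L\left(1+\frac{LB}{a}\right)\right\}\delta_{j-1}(k).$$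
   Context: $S_{j-1}=\{\sum_{i<j}x_ih_i:x_i\in\mathbb N_0\}$ and $Q_j=\{m\in\mathbb N_0: mh_j\in S_{j-1}\}$. The earlier gaps are $h_1,\dots,h_{j-1}$; a nonnegative representation of an integer $N$ using at most $L$ earlier gaps, each no larger than $Bh_j$, is a vector $x\in\mathbb N_0^{j-1}$ with $\sum_{i<j}x_ih_i=N$, $\|x\|_1\le L$ (gaps counted with multiplicity), and $h_i\le Bh_j$ whenever $x_i>0$. A numerical semigroup is a submonoid $Q$ of $(\mathbb N_0,+)$ with finite complement; its genus $g(Q)$ is $|\mathbb N_0\setminus Q|$ and its conductor $\operatorname{cond}(Q)$ is the least $c\ge 0$ such that every integer $\ge c$ lies in $Q$. $M_j=\lfloor(n-1)/h_j\rfloor$ and $g_j^{(n)}=|\{1\le m\le M_j: m\notin Q_j\}|$. $\lambda_j(H)=\min\{\|x\|_1: x\in\mathbb Z^{j-1},\ \sum_{i<j}x_ih_i=h_j\}$, with $\min\varnothing=+\infty$. $\lVert x\rVert_{\mathbb T}$ is the distance from $x$ to the nearest integer, and $\delta_s(k)=\max_{1\le i\le s}\lVert kh_i/n\rVert_{\mathbb T}$.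
   Formalization: The parameters L, B ≥ 1 are taken rational; the case of real L, B follows by replacing L with ⌊L⌋ and B with ⌊Bh_j⌋/h_j, which leaves the hypotheses unchanged and only lowers the bounds. -}

module Defs where

open import Level using (0ℓ)
open import Data.Nat as ℕ using (ℕ; suc; NonZero)
import Data.Nat.Properties as ℕ
open import Data.Integer as ℤ using (ℤ; +_)
import Data.Integer.Properties as ℤ
open import Data.Rational as ℚ using (ℚ; 0ℚ; 1ℚ)
open import Data.Fin as Fin using (Fin; toℕ; fromℕ; inject)
open import Data.Fin.Properties using (≤fromℕ; toℕ-injective)
open import Data.List using (List; length)
import Data.List.Membership.Propositional as List
open import Data.List.Relation.Unary.Unique.Propositional using (Unique)
open import Data.Vec.Functional using (Vector; foldr)
open import Data.Product using (∃; ∃-syntax; _×_; _,_)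
open import Data.Sum using (inj₁; inj₂)
open import Data.Empty using (⊥)
open import Function using (_∘_; _⇔_)
open import Relation.Binary.PropositionalEquality using (_≡_; refl; sym; trans; cong)
open import Relation.Nullary.Construct.Add.Supremum using (_⁺; [_]; ⊤⁺)
open import Relation.Unary using (Pred; _∈_; _∉_; ∁; Empty)
open import Algebra.Properties.Monoid.Sum ℕ.+-0-monoid using (sum)
open import Algebra.Properties.Monoid.Sum ℤ.+-0-monoid using () renaming (sum to sumℤ)

------------------------------------------------------------------------
-- Minima, cardinalities and numerical semigroups

-- The minimum of a set of naturals, with min ∅ = +∞.
IsMin : Pred ℕ 0ℓ → Pred (ℕ ⁺) 0ℓ
IsMin P [ k ] = k ∈ P × (∀ m → m ∈ P → k ℕ.≤ m)
IsMin P ⊤⁺    = Empty P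

fromNat : ℕ → ℚ
fromNat m = + m ℚ./ 1

infix 4 _≤⁺_

_≤⁺_ : ℕ ⁺ → ℚ → Set
[ k ] ≤⁺ q = fromNat k ℚ.≤ q
⊤⁺    ≤⁺ q = ⊥

HasCard : Pred ℕ 0ℓ → ℕ → Set
HasCard P c = ∃[ xs ] Unique xs × (∀ m → m List.∈ xs ⇔ m ∈ P) × length xs ≡ c

record IsNumericalSemigroup (Q : Pred ℕ 0ℓ) : Set where
  field
    0∈       : 0 ∈ Q
    +-closed : ∀ {l m} → l ∈ Q → m ∈ Q → l ℕ.+ m ∈ Q
    cofinite : ∃ (HasCard (∁ Q))

HasGenus : Pred ℕ 0ℓ → ℕ → Set
HasGenus Q = HasCard (∁ Q)

HasConductor : Pred ℕ 0ℓ → ℕ → Set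
HasConductor Q c = IsMin (λ b → ∀ m → b ℕ.≤ m → m ∈ Q) [ c ]

------------------------------------------------------------------------
-- Gap sequences

-- h₁ > ⋯ > hₚ = 1 with p = suc q; the entry at i : Fin (suc q) is h₍ᵢ₊₁₎.
record GapSequence (q : ℕ) : Set where
  field
    gap        : Vector ℕ (suc q)
    decreasing : ∀ {i k} → i Fin.< k → gap k ℕ.< gap i
    last≡1     : gap (fromℕ q) ≡ 1

  gap-nonZero : ∀ i → NonZero (gap i)
  gap-nonZero i with ℕ.m≤n⇒m<n∨m≡n (≤fromℕ i)
  ... | inj₁ i<q = ℕ.>-nonZero (ℕ.≤-<-trans ℕ.z≤n (decreasing i<q))
  ... | inj₂ i≡q = ℕ.>-nonZero (ℕ.≤-reflexive
                     (sym (trans (cong gap (toℕ-injective i≡q)) last≡1)))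

  -- A position j : Fin (suc q) stands for the 1-based index toℕ j + 1, so
  -- there are toℕ j gaps before it and Fin′ j indexes exactly those.
  earlier : ∀ j → Vector ℕ (toℕ j)
  earlier j i = gap (inject {i = j} i)

open GapSequence public

module _ {q : ℕ} (H : GapSequence q) (j : Fin (suc q)) where

  -- x ∈ ℕ₀^{j-1} with Σ_{i<j} xᵢhᵢ = N
  Represents : Vector ℕ (toℕ j) → ℕ → Set
  Represents x N = sum (λ i → x i ℕ.* earlier H j i) ≡ N

  -- S_{j-1}
  S : Pred ℕ 0ℓ
  S N = ∃[ x ] Represents x N

  -- Q_j
  Q : Pred ℕ 0ℓ
  Q m = m ℕ.* gap H j ∈ S

  -- N has a nonnegative representation using at most L earlier gaps,
  -- each no larger than B hⱼ.
  HasRep : (L B : ℚ) → Pred ℕ 0ℓ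
  HasRep L B N = ∃[ x ] Represents x N
    × fromNat (sum x) ℚ.≤ L
    × (∀ i → 0 ℕ.< x i → fromNat (earlier H j i) ℚ.≤ B ℚ.* fromNat (gap H j))

  -- M_j = ⌊(n-1)/hⱼ⌋
  M : ℕ → ℕ
  M n = ℕ._/_ (n ℕ.∸ 1) (gap H j) {{gap-nonZero H j}}

  -- The value g_j^{(n)}
  HasTruncatedGenus : (n : ℕ) → ℕ → Set
  HasTruncatedGenus n = HasCard (λ m → 1 ℕ.≤ m × m ℕ.≤ M n × m ∉ Q)

  -- The value λ_j(H)
  IsLambda : Pred (ℕ ⁺) 0ℓ
  IsLambda = IsMin λ l → ∃[ x ]
      sumℤ (λ i → x i ℤ.* + earlier H j i) ≡ + gap H j
    × sum (ℤ.∣_∣ ∘ x) ≡ l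

------------------------------------------------------------------------
-- Distance to the nearest integer

‖_‖ₜ : ℚ → ℚ
‖ x ‖ₜ = ℚ.∣ x ℚ.- ℚ.round x ℚ./ 1 ∣

module _ {q : ℕ} (n : ℕ) .{{_ : NonZero n}} (H : GapSequence q) where

  -- δ_{j-1}(k).  All entries are nonnegative, so starting the maximum at 0
  -- does not affect it when there is at least one earlier gap.
  δ : Fin (suc q) → ℕ → ℚ
  δ j k = foldr ℚ._⊔_ 0ℚ (λ i → ‖ + (k ℕ.* earlier H j i) ℚ./ n ‖ₜ)

-- min {2LB - 1, L(1 + LB/a)}
bound : (L B : ℚ) (a : ℕ) .{{_ : NonZero a}} → ℚ
bound L B a = (fromNat 2 ℚ.* L ℚ.* B ℚ.- 1ℚ)
        ℚ.⊓ (L ℚ.* (1ℚ ℚ.+ L ℚ.* B ℚ.* (+ 1 ℚ./ a)))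

{-# OPTIONS --safe #-}
-- A representation of m h by at most L gaps of size at most B h forces m ≤ LB,
-- so a and every w_r are at most some C ≤ LB.  Each m ≥ C − 1 is then
-- w_r + t a with r = m mod a and t ≥ 0, hence lies in Q.  Differences of
-- multiples of h give integer representations of h = h_j: C h − (C − 1) h has norm
-- at most 2C − 1, because m h is a sum of at most m earlier gaps, and
-- w₁ h − t (a h) with t = (w₁ − 1)/a has norm at most L + t L.  The last bound is
-- the triangle inequality for the distance to the nearest integer.
module Submission where

open import Defs
open import Level using (0ℓ)
open import Data.Bool using (true; false)
open import Data.Empty using (⊥-elim)
open import Data.Fin using (Fin; zero; suc; toℕ; inject)
open import Data.Fin.Properties using (toℕ-inject; toℕ<n; ∀-cons)
open import Data.Integer as ℤ using (ℤ; +_; -[1+_])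
import Data.Integer.DivMod as ℤ
import Data.Integer.Properties as ℤ
open import Data.Integer.Solver using () renaming (module +-*-Solver to ℤ-Solver)
open import Data.List using (filter; upTo)
open import Data.List.Membership.Propositional.Properties using (∈-filter⁺; ∈-filter⁻; ∈-upTo⁺; ∈-upTo⁻)
open import Data.List.Properties using (length-filter; length-upTo)
open import Data.List.Relation.Unary.Unique.Propositional.Properties using (filter⁺; upTo⁺)
open import Data.Nat as ℕ using (ℕ; suc; NonZero; _%_)
import Data.Nat.DivMod as ℕ
import Data.Nat.Properties as ℕ
open import Data.Nat.Solver using () renaming (module +-*-Solver to ℕ-Solver)
open import Data.Product using (∃-syntax; _×_; _,_; proj₁; proj₂)
open import Data.Rational as ℚ using (ℚ; 0ℚ; 1ℚ; ½)
open import Data.Rational.Literals using (fromℤ)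
import Data.Rational.Properties as ℚ
open import Data.Rational.Solver using (module +-*-Solver)
import Data.Rational.Unnormalised as ℚᵘ
import Data.Rational.Unnormalised.Properties as ℚᵘ
open import Data.Sum using (_⊎_; inj₁; inj₂)
open import Data.Vec.Functional using (Vector; []; _∷_; foldr)
open import Function using (_∘_; _⇔_; mk⇔; Equivalence)
open import Relation.Binary.PropositionalEquality
open import Relation.Nullary using (yes; no; Dec; ¬?; _×-dec_; _⊎-dec_; _→-dec_; map′)
open import Relation.Nullary.Construct.Add.Supremum using ([_])
open import Relation.Unary using (Pred; Decidable; _∈_)
open import Algebra.Properties.CommutativeMonoid.Sum ℕ.+-0-commutativeMonoid using (∑-distrib-+)
open import Algebra.Properties.Monoid.Sum ℕ.+-0-monoid using (sum; sum-cong-≗; sum-replicate-zero)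
open import Algebra.Properties.Monoid.Sum ℤ.+-0-monoid using () renaming (sum to sumℤ; sum-cong-≗ to sumℤ-cong-≗)

-- The embedding of ℤ in ℚ

ι : ℤ → ℚ
ι z = z ℚ./ 1

-- `z / 1` is produced by a gcd normalisation that is stuck on a variable `z`, while `fromℤ z` is an
-- explicit fraction with denominator 1; arithmetic on `ι` is done by passing to it.
ι≡fromℤ : ∀ z → ι z ≡ fromℤ z
ι≡fromℤ z = ℚ.↥p/↧p≡p (fromℤ z)

ι-+ : ∀ y z → ι (y ℤ.+ z) ≡ ι y ℚ.+ ι z
ι-+ y z = begin
  -- `fromℤ y + fromℤ z` unfolds to `(y * 1 + z * 1) / 1`.
  ι (y ℤ.+ z)                     ≡⟨ cong ι (cong₂ ℤ._+_ (ℤ.*-identityʳ y) (ℤ.*-identityʳ z)) ⟨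
  fromℤ y ℚ.+ fromℤ z             ≡⟨ cong₂ ℚ._+_ (ι≡fromℤ y) (ι≡fromℤ z) ⟨
  ι y ℚ.+ ι z                     ∎
  where open ≡-Reasoning

ι-* : ∀ y z → ι (y ℤ.* z) ≡ ι y ℚ.* ι z
ι-* y z = sym (cong₂ ℚ._*_ (ι≡fromℤ y) (ι≡fromℤ z))

fromNat-* : ∀ m n → fromNat (m ℕ.* n) ≡ fromNat m ℚ.* fromNat n
fromNat-* m n = trans (cong ι (ℤ.pos-* m n)) (ι-* (+ m) (+ n))

ι-neg : ∀ z → ι (ℤ.- z) ≡ ℚ.- ι z
ι-neg z = begin
  ι (ℤ.- z)      ≡⟨ ι≡fromℤ (ℤ.- z) ⟩
  fromℤ (ℤ.- z)  ≡⟨ fromℤ-neg z ⟩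
  ℚ.- fromℤ z    ≡⟨ cong ℚ.-_ (ι≡fromℤ z) ⟨
  ℚ.- ι z        ∎
  where
  open ≡-Reasoning
  fromℤ-neg : ∀ z → fromℤ (ℤ.- z) ≡ ℚ.- fromℤ z
  fromℤ-neg (+ ℕ.zero)  = refl
  fromℤ-neg (+ (suc n)) = refl
  fromℤ-neg -[1+ n ]    = refl

ι-- : ∀ y z → ι (y ℤ.- z) ≡ ι y ℚ.- ι z
ι-- y z = trans (ι-+ y (ℤ.- z)) (cong (ι y ℚ.+_) (ι-neg z))

∣ι∣ : ∀ z → ℚ.∣ ι z ∣ ≡ fromNat ℤ.∣ z ∣
∣ι∣ z = trans (cong ℚ.∣_∣ (ι≡fromℤ z)) (sym (ι≡fromℤ (+ ℤ.∣ z ∣)))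

ι-mono-≤ : ∀ {y z} → y ℤ.≤ z → ι y ℚ.≤ ι z
ι-mono-≤ {y} {z} y≤z = subst₂ ℚ._≤_ (sym (ι≡fromℤ y)) (sym (ι≡fromℤ z))
  (ℚ.*≤* (subst₂ ℤ._≤_ (sym (ℤ.*-identityʳ y)) (sym (ℤ.*-identityʳ z)) y≤z))

fromNat-mono-≤ : ∀ {m n} → m ℕ.≤ n → fromNat m ℚ.≤ fromNat n
fromNat-mono-≤ m≤n = ι-mono-≤ (ℤ.+≤+ m≤n)

fromNat-nonNeg : ∀ m → ℚ.NonNegative (fromNat m)
fromNat-nonNeg m = ℚ.nonNegative {fromNat m} (fromNat-mono-≤ {0} {m} ℕ.z≤n)

fromNat-mono-< : ∀ {m n} → m ℕ.< n → fromNat m ℚ.< fromNat n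
fromNat-mono-< {m} {n} m<n = subst₂ ℚ._<_ (sym (ι≡fromℤ (+ m))) (sym (ι≡fromℤ (+ n)))
  (ℚ.*<* (subst₂ ℤ._<_ (sym (ℤ.*-identityʳ (+ m))) (sym (ℤ.*-identityʳ (+ n))) (ℤ.+<+ m<n)))

-- Both sides are normalised fractions, so they are compared as unnormalised rationals, where
-- equality is cross-multiplication.
/-as-* : ∀ z n .{{_ : NonZero n}} → z ℚ./ n ≡ ι z ℚ.* (+ 1 ℚ./ n)
/-as-* z n@(suc n-1) = ℚ.toℚᵘ-injective (begin
  ℚ.toℚᵘ (z ℚ./ n)                        ≈⟨ ℚ.toℚᵘ-fromℚᵘ (ℚᵘ.mkℚᵘ z n-1) ⟩
  ℚᵘ.mkℚᵘ z n-1                           ≈⟨ ℚᵘ.*≡* (cong₂ ℤ._*_ (ℤ.*-identityʳ z) (cong +_ (sym (ℕ.+-identityʳ n)))) ⟨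
  ℚᵘ.mkℚᵘ z 0 ℚᵘ.* ℚᵘ.mkℚᵘ (+ 1) n-1      ≈⟨ ℚᵘ.*-cong (ℚ.toℚᵘ-fromℚᵘ (ℚᵘ.mkℚᵘ z 0)) (ℚ.toℚᵘ-fromℚᵘ (ℚᵘ.mkℚᵘ (+ 1) n-1)) ⟨
  ℚ.toℚᵘ (ι z) ℚᵘ.* ℚ.toℚᵘ (+ 1 ℚ./ n)    ≈⟨ ℚ.toℚᵘ-homo-* (ι z) (+ 1 ℚ./ n) ⟨
  ℚ.toℚᵘ (ι z ℚ.* (+ 1 ℚ./ n))            ∎)
  where open ℚᵘ.≃-Reasoning

n*1/n≡1 : ∀ n .{{_ : NonZero n}} → fromNat n ℚ.* (+ 1 ℚ./ n) ≡ 1ℚ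
n*1/n≡1 n@(suc n-1) = begin
  fromNat n ℚ.* (+ 1 ℚ./ n) ≡⟨ /-as-* (+ n) n ⟨
  + n ℚ./ n                 ≡⟨ ℚ.fromℚᵘ-cong {ℚᵘ.mkℚᵘ (+ n) n-1} {ℚᵘ.mkℚᵘ (+ 1) 0} (ℚᵘ.*≡* (ℤ.*-comm (+ n) (+ 1))) ⟩
  1ℚ                        ∎
  where open ≡-Reasoning

-- Distance to the nearest integer

floor-≤ : ∀ p → ι (ℚ.floor p) ℚ.≤ p
floor-≤ p@record{} = subst (ℚ._≤ p) (sym (ι≡fromℤ ⌊p⌋))
  (ℚ.*≤* (subst (⌊p⌋ ℤ.* ℚ.↧ p ℤ.≤_) (sym (ℤ.*-identityʳ (ℚ.↥ p))) (ℤ.[n/d]*d≤n (ℚ.↥ p) (ℚ.↧ p))))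
  where ⌊p⌋ = ℚ.floor p

<-floor+1 : ∀ p → p ℚ.< 1ℚ ℚ.+ ι (ℚ.floor p)
<-floor+1 p@record{} = subst (p ℚ.<_) (trans (sym (ι≡fromℤ (ℤ.suc ⌊p⌋))) (ι-+ (+ 1) ⌊p⌋))
  (ℚ.*<* (subst₂ ℤ._<_ (sym (ℤ.*-identityʳ (ℚ.↥ p)))
                       (cong (λ z → ℤ.suc z ℤ.* ℚ.↧ p) (sym (ℤ.div-pos-is-/ℕ (ℚ.↥ p) (ℚ.↧ₙ p))))
                       (ℤ.n<s[n/ℕd]*d (ℚ.↥ p) (ℚ.↧ₙ p))))
  where ⌊p⌋ = ℚ.floor p

-- `ceiling` unfolds only on a matched record; stated separately so that it also applies to `p - ½`,
-- which is not in constructor form.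
ceiling≡-floor- : ∀ p → ℚ.ceiling p ≡ ℤ.- ℚ.floor (ℚ.- p)
ceiling≡-floor- record{} = refl

∣p∣≤q : ∀ {p q} → p ℚ.≤ q → ℚ.- q ℚ.≤ p → ℚ.∣ p ∣ ℚ.≤ q
∣p∣≤q {p} {q} p≤q -q≤p with ℚ.∣p∣≡p∨∣p∣≡-p p
... | inj₁ ∣p∣≡p  = subst (ℚ._≤ q) (sym ∣p∣≡p) p≤q
... | inj₂ ∣p∣≡-p = subst₂ ℚ._≤_ (sym ∣p∣≡-p) (solve 1 (λ x → :- (:- x) := x) refl q)
                      (ℚ.neg-antimono-≤ -q≤p)
  where open +-*-Solver

-- Subtract ½ + f from f ≤ p + ½ < 1 + f, where f is the floor of p + ½.
∣p-floor[p+½]∣≤½ : ∀ p → ℚ.∣ p ℚ.- ι (ℚ.floor (p ℚ.+ ½)) ∣ ℚ.≤ ½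
∣p-floor[p+½]∣≤½ p = ∣p∣≤q
  (subst₂ ℚ._≤_
    (solve 3 (λ x h f → (x :+ h) :+ :- (h :+ f) := x :- f) refl p ½ f)
    (solve 1 (λ f → (con 1ℚ :+ f) :+ :- (con ½ :+ f) := con ½) refl f)
    (ℚ.+-monoˡ-≤ (ℚ.- (½ ℚ.+ f)) (ℚ.<⇒≤ (<-floor+1 (p ℚ.+ ½)))))
  (subst₂ ℚ._≤_
    (solve 2 (λ h f → f :+ :- (h :+ f) := :- h) refl ½ f)
    (solve 3 (λ x h f → (x :+ h) :+ :- (h :+ f) := x :- f) refl p ½ f)
    (ℚ.+-monoˡ-≤ (ℚ.- (½ ℚ.+ f)) (floor-≤ (p ℚ.+ ½))))
  where
  open +-*-Solver
  f = ι (ℚ.floor (p ℚ.+ ½))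

-- `round p` is `floor (p + ½)` for p > 0 and `ceiling (p - ½)` otherwise. The latter is minus the
-- floor of - p + ½, so the second case is the first estimate at - p.
‖p‖≤½ : ∀ p → ‖ p ‖ₜ ℚ.≤ ½
‖p‖≤½ p with p ℚ.≤ᵇ 0ℚ
... | false = ∣p-floor[p+½]∣≤½ p
... | true  = subst (ℚ._≤ ½) eq (∣p-floor[p+½]∣≤½ (ℚ.- p))
  where
  open ≡-Reasoning
  open +-*-Solver
  eq : ℚ.∣ (ℚ.- p) ℚ.- ι (ℚ.floor ((ℚ.- p) ℚ.+ ½)) ∣ ≡ ℚ.∣ p ℚ.- ι (ℚ.ceiling (p ℚ.- ½)) ∣
  eq = begin
    ℚ.∣ (ℚ.- p) ℚ.- ι (ℚ.floor ((ℚ.- p) ℚ.+ ½)) ∣      ≡⟨ cong (λ x → ℚ.∣ (ℚ.- p) ℚ.- ι (ℚ.floor x) ∣)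
                                                        (solve 2 (λ x h → (:- x) :+ h := :- (x :- h)) refl p ½) ⟩
    ℚ.∣ (ℚ.- p) ℚ.- ι (ℚ.floor (ℚ.- (p ℚ.- ½))) ∣      ≡⟨ cong ℚ.∣_∣ (solve 2 (λ x f → (:- x) :- f := :- (x :- (:- f))) refl p
                                                        (ι (ℚ.floor (ℚ.- (p ℚ.- ½))))) ⟩
    ℚ.∣ ℚ.- (p ℚ.- (ℚ.- ι (ℚ.floor (ℚ.- (p ℚ.- ½))))) ∣ ≡⟨ ℚ.∣-p∣≡∣p∣ _ ⟩
    ℚ.∣ p ℚ.- (ℚ.- ι (ℚ.floor (ℚ.- (p ℚ.- ½)))) ∣      ≡⟨ cong (λ x → ℚ.∣ p ℚ.- x ∣) (ι-neg (ℚ.floor (ℚ.- (p ℚ.- ½)))) ⟨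
    ℚ.∣ p ℚ.- ι (ℤ.- ℚ.floor (ℚ.- (p ℚ.- ½))) ∣        ≡⟨ cong (λ z → ℚ.∣ p ℚ.- ι z ∣) (ceiling≡-floor- (p ℚ.- ½)) ⟨
    ℚ.∣ p ℚ.- ι (ℚ.ceiling (p ℚ.- ½)) ∣                ∎

-- A competitor z ≠ round p is at distance at least 1 from round p, hence at
-- least ½ from p.
‖p‖≤∣p-z∣ : ∀ p z → ‖ p ‖ₜ ℚ.≤ ℚ.∣ p ℚ.- ι z ∣
‖p‖≤∣p-z∣ p z with ℚ.round p ℤ.≟ z
... | yes r≡z = ℚ.≤-reflexive (cong (λ y → ℚ.∣ p ℚ.- ι y ∣) r≡z)
... | no  r≢z = begin
  ‖ p ‖ₜ                                         ≤⟨ ‖p‖≤½ p ⟩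
  ½                                              ≤⟨ ℚ.+-monoˡ-≤ (ℚ.- ½) 1≤ ⟩
  ℚ.∣ p ℚ.- ι z ∣ ℚ.+ ½ ℚ.- ½                    ≡⟨ solve 2 (λ x h → x :+ h :- h := x) refl ℚ.∣ p ℚ.- ι z ∣ ½ ⟩
  ℚ.∣ p ℚ.- ι z ∣                                ∎
  where
  open ℚ.≤-Reasoning
  open +-*-Solver
  r = ℚ.round p
  1≤ : 1ℚ ℚ.≤ ℚ.∣ p ℚ.- ι z ∣ ℚ.+ ½
  1≤ = begin
    1ℚ                                           ≤⟨ fromNat-mono-≤ (ℕ.n≢0⇒n>0 (r≢z ∘ ℤ.i-j≡0⇒i≡j r z ∘ ℤ.∣i∣≡0⇒i≡0)) ⟩
    fromNat ℤ.∣ r ℤ.- z ∣                         ≡⟨ ∣ι∣ (r ℤ.- z) ⟨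
    ℚ.∣ ι (r ℤ.- z) ∣                             ≡⟨ cong ℚ.∣_∣ (ι-- r z) ⟩
    ℚ.∣ ι r ℚ.- ι z ∣                             ≡⟨ cong ℚ.∣_∣ (solve 3 (λ x r z → r :- z := (x :- z) :- (x :- r)) refl p (ι r) (ι z)) ⟩
    ℚ.∣ (p ℚ.- ι z) ℚ.- (p ℚ.- ι r) ∣              ≤⟨ ℚ.∣p-q∣≤∣p∣+∣q∣ (p ℚ.- ι z) (p ℚ.- ι r) ⟩
    ℚ.∣ p ℚ.- ι z ∣ ℚ.+ ‖ p ‖ₜ                     ≤⟨ ℚ.+-monoʳ-≤ ℚ.∣ p ℚ.- ι z ∣ (‖p‖≤½ p) ⟩
    ℚ.∣ p ℚ.- ι z ∣ ℚ.+ ½                         ∎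

-- The integer `round p + round q` competes with the one nearest to p + q.
‖p+q‖≤‖p‖+‖q‖ : ∀ p q → ‖ p ℚ.+ q ‖ₜ ℚ.≤ ‖ p ‖ₜ ℚ.+ ‖ q ‖ₜ
‖p+q‖≤‖p‖+‖q‖ p q = begin
  ‖ p ℚ.+ q ‖ₜ                              ≤⟨ ‖p‖≤∣p-z∣ (p ℚ.+ q) (r ℤ.+ s) ⟩
  ℚ.∣ (p ℚ.+ q) ℚ.- ι (r ℤ.+ s) ∣           ≡⟨ cong (λ x → ℚ.∣ (p ℚ.+ q) ℚ.- x ∣) (ι-+ r s) ⟩
  ℚ.∣ (p ℚ.+ q) ℚ.- (ι r ℚ.+ ι s) ∣         ≡⟨ cong ℚ.∣_∣ (solve 4 (λ p q r s → (p :+ q) :- (r :+ s) := (p :- r) :+ (q :- s)) refl p q (ι r) (ι s)) ⟩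
  ℚ.∣ (p ℚ.- ι r) ℚ.+ (q ℚ.- ι s) ∣         ≤⟨ ℚ.∣p+q∣≤∣p∣+∣q∣ (p ℚ.- ι r) (q ℚ.- ι s) ⟩
  ‖ p ‖ₜ ℚ.+ ‖ q ‖ₜ                         ∎
  where
  open ℚ.≤-Reasoning
  open +-*-Solver
  r = ℚ.round p
  s = ℚ.round q

‖zp‖≤∣z∣‖p‖ : ∀ z p → ‖ ι z ℚ.* p ‖ₜ ℚ.≤ fromNat ℤ.∣ z ∣ ℚ.* ‖ p ‖ₜ
‖zp‖≤∣z∣‖p‖ z p = begin
  ‖ ι z ℚ.* p ‖ₜ                            ≤⟨ ‖p‖≤∣p-z∣ (ι z ℚ.* p) (z ℤ.* r) ⟩
  ℚ.∣ ι z ℚ.* p ℚ.- ι (z ℤ.* r) ∣           ≡⟨ cong (λ x → ℚ.∣ ι z ℚ.* p ℚ.- x ∣) (ι-* z r) ⟩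
  ℚ.∣ ι z ℚ.* p ℚ.- ι z ℚ.* ι r ∣           ≡⟨ cong ℚ.∣_∣ (solve 3 (λ z p r → z :* p :- z :* r := z :* (p :- r)) refl (ι z) p (ι r)) ⟩
  ℚ.∣ ι z ℚ.* (p ℚ.- ι r) ∣                 ≡⟨ ℚ.∣p*q∣≡∣p∣*∣q∣ (ι z) (p ℚ.- ι r) ⟩
  ℚ.∣ ι z ∣ ℚ.* ‖ p ‖ₜ                      ≡⟨ cong (ℚ._* ‖ p ‖ₜ) (∣ι∣ z) ⟩
  fromNat ℤ.∣ z ∣ ℚ.* ‖ p ‖ₜ                ∎
  where
  open ℚ.≤-Reasoning
  open +-*-Solver
  r = ℚ.round p

-- Induction on the number of terms: the term with coefficient `x i` costs at most `∣ x i ∣ * D`. It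
-- is applied with c = k / n and D = `δ`.
‖Σxg‖≤∣x∣₁D : ∀ {n} (x : Vector ℤ n) (g : Vector ℕ n) c D →
  (∀ i → ‖ fromNat (g i) ℚ.* c ‖ₜ ℚ.≤ D) →
  ‖ ι (sumℤ (λ i → x i ℤ.* + g i)) ℚ.* c ‖ₜ ℚ.≤ fromNat (sum (ℤ.∣_∣ ∘ x)) ℚ.* D
‖Σxg‖≤∣x∣₁D {ℕ.zero} x g c D g≤D =
  ℚ.≤-reflexive (trans (cong ‖_‖ₜ (ℚ.*-zeroˡ c)) (sym (ℚ.*-zeroˡ D)))
‖Σxg‖≤∣x∣₁D {suc n} x g c D g≤D = begin
  ‖ ι (x zero ℤ.* + g zero ℤ.+ s) ℚ.* c ‖ₜ
    ≡⟨ cong (λ y → ‖ y ℚ.* c ‖ₜ) (trans (ι-+ (x zero ℤ.* + g zero) s) (cong (ℚ._+ ι s) (ι-* (x zero) (+ g zero)))) ⟩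
  ‖ (ι (x zero) ℚ.* fromNat (g zero) ℚ.+ ι s) ℚ.* c ‖ₜ
    ≡⟨ cong ‖_‖ₜ (solve 4 (λ x g s c → (x :* g :+ s) :* c := x :* (g :* c) :+ s :* c) refl (ι (x zero)) (fromNat (g zero)) (ι s) c) ⟩
  ‖ ι (x zero) ℚ.* (fromNat (g zero) ℚ.* c) ℚ.+ ι s ℚ.* c ‖ₜ
    ≤⟨ ‖p+q‖≤‖p‖+‖q‖ (ι (x zero) ℚ.* (fromNat (g zero) ℚ.* c)) (ι s ℚ.* c) ⟩
  ‖ ι (x zero) ℚ.* (fromNat (g zero) ℚ.* c) ‖ₜ ℚ.+ ‖ ι s ℚ.* c ‖ₜ
    ≤⟨ ℚ.+-mono-≤ (‖zp‖≤∣z∣‖p‖ (x zero) (fromNat (g zero) ℚ.* c)) (‖Σxg‖≤∣x∣₁D (x ∘ suc) (g ∘ suc) c D (g≤D ∘ suc)) ⟩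
  fromNat ℤ.∣ x zero ∣ ℚ.* ‖ fromNat (g zero) ℚ.* c ‖ₜ ℚ.+ fromNat t ℚ.* D
    ≤⟨ ℚ.+-monoˡ-≤ (fromNat t ℚ.* D) (ℚ.*-monoˡ-≤-nonNeg (fromNat ℤ.∣ x zero ∣) {{fromNat-nonNeg ℤ.∣ x zero ∣}} (g≤D zero)) ⟩
  fromNat ℤ.∣ x zero ∣ ℚ.* D ℚ.+ fromNat t ℚ.* D
    ≡⟨ ℚ.*-distribʳ-+ D (fromNat ℤ.∣ x zero ∣) (fromNat t) ⟨
  (fromNat ℤ.∣ x zero ∣ ℚ.+ fromNat t) ℚ.* D
    ≡⟨ cong (ℚ._* D) (ι-+ (+ ℤ.∣ x zero ∣) (+ t)) ⟨
  fromNat (ℤ.∣ x zero ∣ ℕ.+ t) ℚ.* D ∎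
  where
  open ℚ.≤-Reasoning
  open +-*-Solver
  s = sumℤ (λ i → x (suc i) ℤ.* + g (suc i))
  t = sum (λ i → ℤ.∣ x (suc i) ∣)

entry≤max : ∀ {n} (v : Vector ℚ n) i → v i ℚ.≤ foldr ℚ._⊔_ 0ℚ v
entry≤max v zero    = ℚ.p≤p⊔q (v zero) _
entry≤max v (suc i) = ℚ.≤-trans (entry≤max (v ∘ suc) i) (ℚ.p≤q⊔p (v zero) _)

0≤max : ∀ {n} (v : Vector ℚ n) → 0ℚ ℚ.≤ foldr ℚ._⊔_ 0ℚ v
0≤max {ℕ.zero} v = ℚ.≤-refl
0≤max {suc n}  v = ℚ.≤-trans (0≤max (v ∘ suc)) (ℚ.p≤q⊔p (v zero) _)

-- Decidable search and cardinalities

-- Linear search from 0: each failure shifts the predicate by one and lowers the known member `b`,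
-- so the search stops.
least : ∀ {P : Pred ℕ 0ℓ} → Decidable P → ∀ {b} → b ∈ P → ∃[ k ] IsMin P [ k ]
least {P} P? {b} Pb with P? 0
... | yes P0 = 0 , P0 , λ _ _ → ℕ.z≤n
... | no ¬P0 with b
...   | ℕ.zero = ⊥-elim (¬P0 Pb)
...   | suc _ with least (P? ∘ suc) Pb
...     | k , Pk , k≤ = suc k , Pk , λ where
            ℕ.zero  P0 → ⊥-elim (¬P0 P0)
            (suc m) Pm → ℕ.s≤s (k≤ m Pm)

-- Since P holds from `d` on, only the finitely many m < d need testing.
eventually? : ∀ {P : Pred ℕ 0ℓ} → Decidable P → ∀ {d} → (∀ m → d ℕ.≤ m → P m) →
  Decidable (λ b → ∀ m → b ℕ.≤ m → P m)
eventually? {P} P? {d} P≥d b = map′ to (λ P≥b {m} _ → P≥b m)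
  (ℕ.allUpTo? (λ m → (b ℕ.≤? m) →-dec P? m) d)
  where
  to : (∀ {m} → m ℕ.< d → b ℕ.≤ m → P m) → ∀ m → b ℕ.≤ m → P m
  to P<d m b≤m with ℕ.<-≤-connex m d
  ... | inj₁ m<d = P<d m<d b≤m
  ... | inj₂ d≤m = P≥d m d≤m

module _ {A : Set} {B : Pred A 0ℓ}
         (any-B? : ∀ {R : Pred A 0ℓ} → Decidable R → Dec (∃[ a ] a ∈ B × a ∈ R)) where

  -- Search one coordinate at a time. Vectors are functions, so a vector agrees with its head
  -- followed by its tail only pointwise; `resp` carries P across this agreement.
  any-vector? : ∀ {n} {P : Pred (Vector A n) 0ℓ} →
    (∀ {x y} → x ≗ y → P x → P y) → Decidable P →
    Dec (∃[ x ] (∀ i → x i ∈ B) × P x)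
  any-vector? {ℕ.zero} resp P? =
    map′ (λ p → [] , (λ ()) , p) (λ (x , _ , p) → resp (λ ()) p) (P? [])
  any-vector? {suc n} {P} resp P? = map′
    (λ (a , Ba , x , Bx , p) → a ∷ x , ∀-cons Ba Bx , p)
    (λ (x , Bx , p) → x zero , Bx zero , x ∘ suc , Bx ∘ suc , resp (∀-cons refl (λ _ → refl)) p)
    (any-B? λ a → any-vector? {P = P ∘ (a ∷_)} (λ x≗y → resp (∀-cons refl x≗y)) (P? ∘ (a ∷_)))

any≤? : ∀ b {R : Pred ℕ 0ℓ} → Decidable R → Dec (∃[ m ] m ℕ.≤ b × m ∈ R)
any≤? b R? = map′ (λ (m , m<1+b , Rm) → m , ℕ.s≤s⁻¹ m<1+b , Rm) (λ (m , m≤b , Rm) → m , ℕ.s≤s m≤b , Rm)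
  (ℕ.anyUpTo? R? (suc b))

any∣∣≤? : ∀ b {R : Pred ℤ 0ℓ} → Decidable R → Dec (∃[ z ] ℤ.∣ z ∣ ℕ.≤ b × z ∈ R)
any∣∣≤? b {R} R? = map′ to from (any≤? b (λ m → R? (+ m) ⊎-dec R? (ℤ.- (+ m))))
  where
  to : ∃[ m ] m ℕ.≤ b × (+ m ∈ R ⊎ ℤ.- (+ m) ∈ R) → ∃[ z ] ℤ.∣ z ∣ ℕ.≤ b × z ∈ R
  to (m , m≤b , inj₁ Rm) = + m , m≤b , Rm
  to (m , m≤b , inj₂ Rm) = ℤ.- (+ m) , subst (ℕ._≤ b) (sym (ℤ.∣-i∣≡∣i∣ (+ m))) m≤b , Rm
  from : ∃[ z ] ℤ.∣ z ∣ ℕ.≤ b × z ∈ R → ∃[ m ] m ℕ.≤ b × (+ m ∈ R ⊎ ℤ.- (+ m) ∈ R)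
  from (+ m      , m≤b , Rm) = m , m≤b , inj₁ Rm
  from (-[1+ m ] , m≤b , Rm) = suc m , m≤b , inj₂ Rm

entry≤sum : ∀ {n} (x : Vector ℕ n) i → x i ℕ.≤ sum x
entry≤sum x zero    = ℕ.m≤m+n (x zero) _
entry≤sum x (suc i) = ℕ.≤-trans (entry≤sum (x ∘ suc) i) (ℕ.m≤n+m _ (x zero))

-- Filtering an enumeration keeps it free of repetitions and cannot lengthen it. Applied to the
-- numbers below `d` it counts the complement of `Q`; applied to that complement it counts the part
-- in 1, ..., `M`.
card-filter : ∀ {P R P′ : Pred ℕ 0ℓ} {c} → HasCard P c → Decidable R → (∀ m → (P m × R m) ⇔ P′ m) →
  ∃[ c′ ] HasCard P′ c′ × c′ ℕ.≤ c
card-filter (xs , unique , ∈xs⇔P , refl) R? P×R⇔P′ =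
  _ , (filter R? xs , filter⁺ R? unique , (λ m → mk⇔
        (λ m∈ → let m∈xs , Rm = ∈-filter⁻ R? m∈
                in Equivalence.to (P×R⇔P′ m) (Equivalence.to (∈xs⇔P m) m∈xs , Rm))
        (λ P′m → let Pm , Rm = Equivalence.from (P×R⇔P′ m) P′m
                 in ∈-filter⁺ R? (Equivalence.from (∈xs⇔P m) Pm) Rm)) , refl)
    , length-filter R? xs

card-< : ∀ b → HasCard (ℕ._< b) b
card-< b = upTo b , upTo⁺ b , (λ m → mk⇔ ∈-upTo⁻ ∈-upTo⁺) , length-upTo b

-- Residues and upper bounds

-- Equal residues and a ≥ 2 exclude n = m + 1, so n ≤ m + 1 already forces n ≤ m, and m - n is a
-- nonnegative multiple of a. This slack of one lets the tail of `Q` start one below the largest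
-- multiplier.
m≡n+[m/a∸n/a]*a : ∀ {m n a} .{{_ : NonZero a}} → 2 ℕ.≤ a → n % a ≡ m % a → n ℕ.≤ suc m →
  m ≡ n ℕ.+ (m ℕ./ a ℕ.∸ n ℕ./ a) ℕ.* a
m≡n+[m/a∸n/a]*a {m} {n} {a} 2≤a n≡m n≤1+m = begin-equality
  m                                           ≡⟨ ℕ.m≡m%n+[m/n]*n m a ⟩
  m % a ℕ.+ k ℕ.* a                           ≡⟨ cong₂ (λ r s → r ℕ.+ s ℕ.* a) (sym n≡m) (sym (ℕ.m+[n∸m]≡n l≤k)) ⟩
  n % a ℕ.+ (l ℕ.+ (k ℕ.∸ l)) ℕ.* a           ≡⟨ solve 4 (λ r l d a → r :+ (l :+ d) :* a := r :+ l :* a :+ d :* a) refl (n % a) l (k ℕ.∸ l) a ⟩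
  n % a ℕ.+ l ℕ.* a ℕ.+ (k ℕ.∸ l) ℕ.* a       ≡⟨ cong (ℕ._+ (k ℕ.∸ l) ℕ.* a) (ℕ.m≡m%n+[m/n]*n n a) ⟨
  n ℕ.+ (k ℕ.∸ l) ℕ.* a                       ∎
  where
  open ℕ.≤-Reasoning
  open ℕ-Solver
  k = m ℕ./ a
  l = n ℕ./ a
  l*a≤1+k*a : l ℕ.* a ℕ.≤ 1 ℕ.+ k ℕ.* a
  l*a≤1+k*a = ℕ.+-cancelˡ-≤ (n % a) _ _ (begin
    n % a ℕ.+ l ℕ.* a         ≡⟨ ℕ.m≡m%n+[m/n]*n n a ⟨
    n                         ≤⟨ n≤1+m ⟩
    suc m                     ≡⟨ cong suc (ℕ.m≡m%n+[m/n]*n m a) ⟩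
    suc (m % a ℕ.+ k ℕ.* a)   ≡⟨ cong (λ r → suc (r ℕ.+ k ℕ.* a)) n≡m ⟨
    suc (n % a ℕ.+ k ℕ.* a)   ≡⟨ ℕ.+-suc (n % a) (k ℕ.* a) ⟨
    n % a ℕ.+ suc (k ℕ.* a)   ∎)
  -- l a ≤ 1 + k a < (k + 1) a because a ≥ 2; hence the truncated subtraction `k ∸ l` is a true one.
  l≤k : l ℕ.≤ k
  l≤k = ℕ.s≤s⁻¹ (ℕ.*-cancelʳ-< a l (suc k) (begin-strict
    l ℕ.* a              ≤⟨ l*a≤1+k*a ⟩
    1 ℕ.+ k ℕ.* a        <⟨ ℕ.+-monoˡ-< (k ℕ.* a) 2≤a ⟩
    a ℕ.+ k ℕ.* a        ∎))

-- A running maximum: the bound is itself one of the values, so it inherits `P`. With `P` meaning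
-- "at most LB", this replaces the rational LB by a natural number.
common-upper-bound : ∀ {P : Pred ℕ 0ℓ} {a} (w : ℕ → ℕ) b → P a → (∀ r → r ℕ.< b → P (w r)) →
  ∃[ c ] P c × a ℕ.≤ c × (∀ r → r ℕ.< b → w r ℕ.≤ c)
common-upper-bound w ℕ.zero Pa Pw = _ , Pa , ℕ.≤-refl , λ _ ()
common-upper-bound {P} {a} w (suc b) Pa Pw
  with common-upper-bound {P} w b Pa (λ r r<b → Pw r (ℕ.m≤n⇒m≤1+n r<b))
... | c , Pc , a≤c , w≤c with ℕ.≤-total (w b) c
...   | inj₁ wb≤c = c , Pc , a≤c , λ r r<1+b → case (ℕ.m<1+n⇒m<n∨m≡n r<1+b)
  where
  case : ∀ {r} → r ℕ.< b ⊎ r ≡ b → w r ℕ.≤ c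
  case (inj₁ r<b)  = w≤c _ r<b
  case (inj₂ refl) = wb≤c
...   | inj₂ c≤wb = w b , Pw b ℕ.≤-refl , ℕ.≤-trans a≤c c≤wb , λ r r<1+b → case (ℕ.m<1+n⇒m<n∨m≡n r<1+b)
  where
  case : ∀ {r} → r ℕ.< b ⊎ r ≡ b → w r ℕ.≤ w b
  case (inj₁ r<b)  = ℕ.≤-trans (w≤c _ r<b) c≤wb
  case (inj₂ refl) = ℕ.≤-refl

-- Representations by gaps

sum-difference : ∀ {n} (x y g : Vector ℕ n) t →
  sumℤ (λ i → (+ x i ℤ.- + t ℤ.* + y i) ℤ.* + g i)
    ≡ + sum (λ i → x i ℕ.* g i) ℤ.- + t ℤ.* + sum (λ i → y i ℕ.* g i)
sum-difference {ℕ.zero} x y g t = sym (cong (λ z → + 0 ℤ.- z) (ℤ.*-zeroʳ (+ t)))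
sum-difference {suc n}  x y g t = begin
  (X ℤ.- T ℤ.* Y) ℤ.* G ℤ.+ sumℤ (λ i → (+ x (suc i) ℤ.- T ℤ.* + y (suc i)) ℤ.* + g (suc i))
    ≡⟨ cong (λ z → (X ℤ.- T ℤ.* Y) ℤ.* G ℤ.+ z) (sum-difference (x ∘ suc) (y ∘ suc) (g ∘ suc) t) ⟩
  (X ℤ.- T ℤ.* Y) ℤ.* G ℤ.+ (+ sx ℤ.- T ℤ.* + sy)
    ≡⟨ solve 6 (λ X Y G T u v → (X :- T :* Y) :* G :+ (u :- T :* v) := (X :* G :+ u) :- T :* (Y :* G :+ v))
         refl X Y G T (+ sx) (+ sy) ⟩
  (X ℤ.* G ℤ.+ + sx) ℤ.- T ℤ.* (Y ℤ.* G ℤ.+ + sy)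
    ≡⟨ cong₂ (λ u v → (u ℤ.+ + sx) ℤ.- T ℤ.* (v ℤ.+ + sy)) (ℤ.pos-* (x zero) (g zero)) (ℤ.pos-* (y zero) (g zero)) ⟨
  + (x zero ℕ.* g zero ℕ.+ sx) ℤ.- T ℤ.* + (y zero ℕ.* g zero ℕ.+ sy) ∎
  where
  open ≡-Reasoning
  open ℤ-Solver
  X = + x zero
  Y = + y zero
  G = + g zero
  T = + t
  sx = sum (λ i → x (suc i) ℕ.* g (suc i))
  sy = sum (λ i → y (suc i) ℕ.* g (suc i))

∣difference∣₁≤ : ∀ {n} (x y : Vector ℕ n) t →
  sum (λ i → ℤ.∣ + x i ℤ.- + t ℤ.* + y i ∣) ℕ.≤ sum x ℕ.+ t ℕ.* sum y
∣difference∣₁≤ {ℕ.zero} x y t = ℕ.z≤n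
∣difference∣₁≤ {suc n}  x y t = begin
  ℤ.∣ + x zero ℤ.- + t ℤ.* + y zero ∣ ℕ.+ _
    ≤⟨ ℕ.+-mono-≤ (ℤ.∣i-j∣≤∣i∣+∣j∣ (+ x zero) (+ t ℤ.* + y zero)) (∣difference∣₁≤ (x ∘ suc) (y ∘ suc) t) ⟩
  x zero ℕ.+ ℤ.∣ + t ℤ.* + y zero ∣ ℕ.+ (sx ℕ.+ t ℕ.* sy)
    ≡⟨ cong (λ z → x zero ℕ.+ z ℕ.+ (sx ℕ.+ t ℕ.* sy)) (ℤ.abs-* (+ t) (+ y zero)) ⟩
  x zero ℕ.+ t ℕ.* y zero ℕ.+ (sx ℕ.+ t ℕ.* sy)
    ≡⟨ solve 5 (λ x y t sx sy → x :+ t :* y :+ (sx :+ t :* sy) := x :+ sx :+ t :* (y :+ sy)) refl (x zero) (y zero) t sx sy ⟩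
  x zero ℕ.+ sx ℕ.+ t ℕ.* (y zero ℕ.+ sy) ∎
  where
  open ℕ.≤-Reasoning
  open ℕ-Solver
  sx = sum (x ∘ suc)
  sy = sum (y ∘ suc)

sum*lower≤weighted : ∀ {n} (x g : Vector ℕ n) {h} → (∀ i → h ℕ.≤ g i) →
  sum x ℕ.* h ℕ.≤ sum (λ i → x i ℕ.* g i)
sum*lower≤weighted {ℕ.zero} x g h≤g = ℕ.z≤n
sum*lower≤weighted {suc n}  x g {h} h≤g = begin
  (x zero ℕ.+ sum (x ∘ suc)) ℕ.* h          ≡⟨ ℕ.*-distribʳ-+ h (x zero) _ ⟩
  x zero ℕ.* h ℕ.+ sum (x ∘ suc) ℕ.* h      ≤⟨ ℕ.+-mono-≤ (ℕ.*-monoʳ-≤ (x zero) (h≤g zero)) (sum*lower≤weighted (x ∘ suc) (g ∘ suc) (h≤g ∘ suc)) ⟩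
  x zero ℕ.* g zero ℕ.+ _                   ∎
  where open ℕ.≤-Reasoning

weighted≤sum*upper : ∀ {n} (x g : Vector ℕ n) {K} → (∀ i → 0 ℕ.< x i → fromNat (g i) ℚ.≤ K) →
  fromNat (sum (λ i → x i ℕ.* g i)) ℚ.≤ fromNat (sum x) ℚ.* K
weighted≤sum*upper {ℕ.zero} x g {K} g≤K = ℚ.≤-reflexive (sym (ℚ.*-zeroˡ K))
weighted≤sum*upper {suc n}  x g {K} g≤K = begin
  fromNat (x zero ℕ.* g zero ℕ.+ s)                        ≡⟨ ι-+ (+ (x zero ℕ.* g zero)) (+ s) ⟩
  fromNat (x zero ℕ.* g zero) ℚ.+ fromNat s                ≤⟨ ℚ.+-mono-≤ (term (x zero) (g≤K zero)) (weighted≤sum*upper (x ∘ suc) (g ∘ suc) (g≤K ∘ suc)) ⟩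
  fromNat (x zero) ℚ.* K ℚ.+ fromNat (sum (x ∘ suc)) ℚ.* K ≡⟨ ℚ.*-distribʳ-+ K (fromNat (x zero)) (fromNat (sum (x ∘ suc))) ⟨
  (fromNat (x zero) ℚ.+ fromNat (sum (x ∘ suc))) ℚ.* K     ≡⟨ cong (ℚ._* K) (ι-+ (+ x zero) (+ sum (x ∘ suc))) ⟨
  fromNat (sum x) ℚ.* K                                    ∎
  where
  open ℚ.≤-Reasoning
  s = sum (λ i → x (suc i) ℕ.* g (suc i))
  term : ∀ {b} a → (0 ℕ.< a → fromNat b ℚ.≤ K) → fromNat (a ℕ.* b) ℚ.≤ fromNat a ℚ.* K
  term ℕ.zero b≤K = ℚ.≤-reflexive (sym (ℚ.*-zeroˡ K))
  term {b} (suc a) b≤K = begin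
    fromNat (suc a ℕ.* b)           ≡⟨ fromNat-* (suc a) b ⟩
    fromNat (suc a) ℚ.* fromNat b   ≤⟨ ℚ.*-monoˡ-≤-nonNeg (fromNat (suc a)) {{fromNat-nonNeg (suc a)}} (b≤K ℕ.z<s) ⟩
    fromNat (suc a) ℚ.* K           ∎

-- Decidability and closure of `Q`, and norms of representations

module _ {q : ℕ} (H : GapSequence q) (j : Fin (suc q)) where

  private
    h = gap H j
    instance
      h≢0 : NonZero h
      h≢0 = gap-nonZero H j

  h≤earlier : ∀ i → h ℕ.≤ earlier H j i
  h≤earlier i = ℕ.<⇒≤ (decreasing H (subst (ℕ._< toℕ j) (sym (toℕ-inject {i = j} i)) (toℕ<n i)))

  earlier-nonZero : ∀ i → NonZero (earlier H j i)
  earlier-nonZero i = gap-nonZero H (inject {i = j} i)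

  -- Earlier gaps are at least 1, so the coefficients in a representation of N are at most N and a
  -- finite search decides.
  S? : Decidable (S H j)
  S? N = map′ (λ (x , _ , r) → x , r) (λ (x , r) → x , x≤N x r , r)
    (any-vector? (any≤? N) {P = λ x → Represents H j x N}
      (λ x≗y r → trans (sym (sum-cong-≗ λ i → cong (ℕ._* earlier H j i) (x≗y i))) r)
      (λ x → sum (λ i → x i ℕ.* earlier H j i) ℕ.≟ N))
    where
    x≤N : ∀ x → Represents H j x N → ∀ i → x i ℕ.≤ N
    x≤N x r i = begin
      x i                                       ≤⟨ ℕ.m≤m*n (x i) (earlier H j i) {{earlier-nonZero i}} ⟩
      x i ℕ.* earlier H j i                     ≤⟨ entry≤sum (λ i → x i ℕ.* earlier H j i) i ⟩
      sum (λ i → x i ℕ.* earlier H j i)         ≡⟨ r ⟩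
      N                                         ∎
      where open ℕ.≤-Reasoning

  Q? : Decidable (Q H j)
  Q? m = S? (m ℕ.* h)

  -- The set of norms whose minimum is λ_j(H), as in `IsLambda`.
  IntegerNorm : Pred ℕ 0ℓ
  IntegerNorm l = ∃[ x ] sumℤ (λ i → x i ℤ.* + earlier H j i) ≡ + h × sum (ℤ.∣_∣ ∘ x) ≡ l

  -- A vector of norm l has entries between -l and l, so the search is finite.
  IntegerNorm? : Decidable IntegerNorm
  IntegerNorm? l = map′ (λ (x , _ , r) → x , r)
    (λ (x , eq , norm) → x , (λ i → subst (ℤ.∣ x i ∣ ℕ.≤_) norm (entry≤sum (ℤ.∣_∣ ∘ x) i)) , eq , norm)
    (any-vector? (any∣∣≤? l)
      (λ x≗y (eq , norm) →
          trans (sym (sumℤ-cong-≗ λ i → cong (ℤ._* + earlier H j i) (x≗y i))) eq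
        , trans (sym (sum-cong-≗ λ i → cong ℤ.∣_∣ (x≗y i))) norm)
      (λ x → (sumℤ (λ i → x i ℤ.* + earlier H j i) ℤ.≟ + h) ×-dec (sum (ℤ.∣_∣ ∘ x) ℕ.≟ l)))

  Q-0 : 0 ∈ Q H j
  Q-0 = (λ _ → 0) , sum-replicate-zero (toℕ j)

  Q-+ : ∀ {l m} → l ∈ Q H j → m ∈ Q H j → l ℕ.+ m ∈ Q H j
  Q-+ {l} {m} (x , rx) (y , ry) = (λ i → x i ℕ.+ y i) , (begin
    sum (λ i → (x i ℕ.+ y i) ℕ.* g i)                  ≡⟨ sum-cong-≗ (λ i → ℕ.*-distribʳ-+ (g i) (x i) (y i)) ⟩
    sum (λ i → x i ℕ.* g i ℕ.+ y i ℕ.* g i)            ≡⟨ ∑-distrib-+ (λ i → x i ℕ.* g i) (λ i → y i ℕ.* g i) ⟩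
    sum (λ i → x i ℕ.* g i) ℕ.+ sum (λ i → y i ℕ.* g i) ≡⟨ cong₂ ℕ._+_ rx ry ⟩
    l ℕ.* h ℕ.+ m ℕ.* h                                ≡⟨ ℕ.*-distribʳ-+ h l m ⟨
    (l ℕ.+ m) ℕ.* h                                    ∎)
    where
    open ≡-Reasoning
    g = earlier H j

  Q-* : ∀ t {m} → m ∈ Q H j → t ℕ.* m ∈ Q H j
  Q-* ℕ.zero  _ = Q-0
  Q-* (suc t) {m} m∈Q = Q-+ {m} {t ℕ.* m} m∈Q (Q-* t m∈Q)

  -- As every earlier gap exceeds h, m h is a sum of at most m of them.
  ∣rep∣₁≤ : ∀ {m} x → Represents H j x (m ℕ.* h) → sum x ℕ.≤ m
  ∣rep∣₁≤ {m} x r = ℕ.*-cancelʳ-≤ (sum x) m h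
    (subst (sum x ℕ.* h ℕ.≤_) r (sum*lower≤weighted x (earlier H j) h≤earlier))

  -- The vector x - t y represents m h - t l h = h. The triples (m, l, t) used are (d + 1, d, 1) and
  -- (w 1, a, w 1 / a).
  norm-of-difference : ∀ {m l t} x y → Represents H j x (m ℕ.* h) → Represents H j y (l ℕ.* h) →
    m ≡ 1 ℕ.+ t ℕ.* l → ∃[ k ] IntegerNorm k × k ℕ.≤ sum x ℕ.+ t ℕ.* sum y
  norm-of-difference {m} {l} {t} x y rx ry m≡1+tl =
    _ , ((λ i → + x i ℤ.- + t ℤ.* + y i) , eq , refl) , ∣difference∣₁≤ x y t
    where
    open ≡-Reasoning
    open ℤ-Solver
    eq : sumℤ (λ i → (+ x i ℤ.- + t ℤ.* + y i) ℤ.* + earlier H j i) ≡ + h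
    eq = begin
      _                                                       ≡⟨ sum-difference x y (earlier H j) t ⟩
      _                                                       ≡⟨ cong₂ (λ u v → + u ℤ.- + t ℤ.* + v) rx ry ⟩
      + (m ℕ.* h) ℤ.- + t ℤ.* + (l ℕ.* h)                     ≡⟨ cong₂ (λ u v → u ℤ.- + t ℤ.* v) (ℤ.pos-* m h) (ℤ.pos-* l h) ⟩
      + m ℤ.* + h ℤ.- + t ℤ.* (+ l ℤ.* + h)                   ≡⟨ cong (λ u → + u ℤ.* + h ℤ.- + t ℤ.* (+ l ℤ.* + h)) m≡1+tl ⟩
      (+ 1 ℤ.+ + (t ℕ.* l)) ℤ.* + h ℤ.- + t ℤ.* (+ l ℤ.* + h) ≡⟨ cong (λ u → (+ 1 ℤ.+ u) ℤ.* + h ℤ.- + t ℤ.* (+ l ℤ.* + h)) (ℤ.pos-* t l) ⟩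
      (+ 1 ℤ.+ + t ℤ.* + l) ℤ.* + h ℤ.- + t ℤ.* (+ l ℤ.* + h) ≡⟨ solve 3 (λ t l h → (con (+ 1) :+ t :* l) :* h :- t :* (l :* h) := h) refl (+ t) (+ l) (+ h) ⟩
      + h                                                     ∎

  -- At most L gaps of size at most B h sum to m h, so m h ≤ L B h; then h > 0 is cancelled.
  multiplier≤LB : ∀ {L B} → 1ℚ ℚ.≤ B → ∀ m → m ℕ.* h ∈ HasRep H j L B → fromNat m ℚ.≤ L ℚ.* B
  multiplier≤LB {L} {B} 1≤B m (x , r , ∣x∣≤L , gaps≤Bh) = ℚ.*-cancelʳ-≤-pos (fromNat h) {{h>0}} (begin
    fromNat m ℚ.* fromNat h                              ≡⟨ fromNat-* m h ⟨
    fromNat (m ℕ.* h)                                    ≡⟨ cong fromNat r ⟨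
    fromNat (sum (λ i → x i ℕ.* earlier H j i))          ≤⟨ weighted≤sum*upper x (earlier H j) gaps≤Bh ⟩
    fromNat (sum x) ℚ.* (B ℚ.* fromNat h)                ≤⟨ ℚ.*-monoʳ-≤-nonNeg (B ℚ.* fromNat h) {{Bh≥0}} ∣x∣≤L ⟩
    L ℚ.* (B ℚ.* fromNat h)                              ≡⟨ ℚ.*-assoc L B (fromNat h) ⟨
    L ℚ.* B ℚ.* fromNat h                                ∎)
    where
    open ℚ.≤-Reasoning
    h>0 : ℚ.Positive (fromNat h)
    h>0 = ℚ.positive {fromNat h} (ℚ.<-≤-trans (ℚ.positive⁻¹ 1ℚ) (fromNat-mono-≤ {1} {h} (ℕ.>-nonZero⁻¹ h)))
    Bh≥0 : ℚ.NonNegative (B ℚ.* fromNat h)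
    Bh≥0 = ℚ.nonNeg*nonNeg⇒nonNeg B {{ℚ.nonNegative (ℚ.≤-trans (ℚ.nonNegative⁻¹ 1ℚ) 1≤B)}}
                                  (fromNat h) {{fromNat-nonNeg h}}

-- Cofiniteness of `Q`: conductor, genus and the first norm bound

-- The bound is kept as d + 1 ≤ LB because the spare 1 yields both the strict genus inequality and
-- the -1 in 2LB - 1.
Q-eventually-all : ∀ {q} (H : GapSequence q) (j : Fin (suc q)) {L B} → 1ℚ ℚ.≤ B →
  ∀ {a} .{{_ : NonZero a}} → 2 ℕ.≤ a → a ∈ Q H j → a ℕ.* gap H j ∈ HasRep H j L B →
  ∀ w → (∀ r → r ℕ.< a → w r ∈ Q H j × w r % a ≡ r % a × w r ℕ.* gap H j ∈ HasRep H j L B) →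
  ∃[ d ] fromNat (suc d) ℚ.≤ L ℚ.* B × (∀ m → d ℕ.≤ m → m ∈ Q H j)
Q-eventually-all H j {L} {B} 1≤B {a} 2≤a a∈Q a-rep w w-rep
  with common-upper-bound {λ m → fromNat m ℚ.≤ L ℚ.* B} w a
    (multiplier≤LB H j 1≤B a a-rep)
    (λ r r<a → multiplier≤LB H j 1≤B (w r) (proj₂ (proj₂ (w-rep r r<a))))
-- The common bound is at least a ≥ 2, hence a successor d + 1.
... | ℕ.zero , _ , a≤0 , _ = ⊥-elim (ℕ.<⇒≱ (ℕ.<-≤-trans ℕ.z<s 2≤a) a≤0)
... | suc d , d+1≤LB , _ , w≤d+1 = d , d+1≤LB , Q≥d
  where
  Q≥d : ∀ m → d ℕ.≤ m → m ∈ Q H j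
  Q≥d m d≤m = subst (_∈ Q H j) (sym m≡w+ta)
    (Q-+ H j {w r} {t ℕ.* a} (proj₁ (w-rep r r<a)) (Q-* H j t a∈Q))
    where
    r = m % a
    r<a = ℕ.m%n<n m a
    t = m ℕ./ a ℕ.∸ w r ℕ./ a
    m≡w+ta : m ≡ w r ℕ.+ t ℕ.* a
    -- Here w r ≤ d + 1 ≤ m + 1, which is exactly the slack permitted.
    m≡w+ta = m≡n+[m/a∸n/a]*a 2≤a
      (trans (proj₁ (proj₂ (w-rep r r<a))) (ℕ.m%n%n≡m%n m a))
      (ℕ.≤-trans (w≤d+1 r r<a) (ℕ.s≤s d≤m))

module EventuallyAll {q : ℕ} (H : GapSequence q) (j : Fin (suc q)) (L B : ℚ)
  {d : ℕ} (d+1≤LB : fromNat (suc d) ℚ.≤ L ℚ.* B) (Q≥d : ∀ m → d ℕ.≤ m → m ∈ Q H j) where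

  -- Every number outside `Q` is below `d`, so the complement is filtered from 0, ..., d - 1.
  genus : ∃[ g ] HasGenus (Q H j) g × g ℕ.≤ d
  genus = card-filter (card-< d) (λ m → ¬? (Q? H j m)) λ m →
    mk⇔ proj₂ (λ m∉Q → ℕ.≰⇒> (m∉Q ∘ Q≥d m) , m∉Q)

  isNumericalSemigroup : IsNumericalSemigroup (Q H j)
  isNumericalSemigroup = record
    { 0∈       = Q-0 H j
    ; +-closed = λ {l} {m} → Q-+ H j {l} {m}
    ; cofinite = proj₁ genus , proj₁ (proj₂ genus)
    }

  -- The tail from `d` on lies in `Q`, so the least such start is at most d < d + 1 ≤ LB.
  conductor : ∃[ c ] HasConductor (Q H j) c × fromNat c ℚ.≤ L ℚ.* B
  conductor with least (eventually? (Q? H j) Q≥d) Q≥d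
  ... | c , Q≥c , c≤ = c , (Q≥c , c≤) ,
    ℚ.≤-trans (fromNat-mono-≤ {c} {suc d} (ℕ.m≤n⇒m≤1+n (c≤ d Q≥d))) d+1≤LB

  genera : ∀ n → ∃[ γ ] ∃[ g ] HasTruncatedGenus H j n γ × HasGenus (Q H j) g
    × γ ℕ.≤ g × fromNat g ℚ.< L ℚ.* B
  genera n =
    let g , hasGenus , g≤d = genus
        γ , hasγ , γ≤g = card-filter hasGenus (λ m → (1 ℕ.≤? m) ×-dec (m ℕ.≤? M H j n)) λ m →
          mk⇔ (λ (m∉Q , 1≤m , m≤M) → 1≤m , m≤M , m∉Q) (λ (1≤m , m≤M , m∉Q) → m∉Q , 1≤m , m≤M)
    in γ , g , hasγ , hasGenus , γ≤g , ℚ.<-≤-trans (fromNat-mono-< {g} {suc d} (ℕ.s≤s g≤d)) d+1≤LB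

  -- Any representations of (d + 1) h and d h will do: their norms are at most d + 1 and d, and the
  -- difference has norm at most 2 (d + 1) - 1.
  norm≤2LB-1 : ∃[ k ] IntegerNorm H j k × fromNat k ℚ.≤ fromNat 2 ℚ.* L ℚ.* B ℚ.- 1ℚ
  norm≤2LB-1 with Q≥d (suc d) (ℕ.n≤1+n d) | Q≥d d ℕ.≤-refl
  ... | x , rx | y , ry
    with norm-of-difference H j {suc d} {d} {1} x y rx ry (cong suc (sym (ℕ.*-identityˡ d)))
  ...   | k , k-norm , k≤ = k , k-norm , (begin
    fromNat k                                    ≡⟨ solve 1 (λ k → k := con 1ℚ :+ k :- con 1ℚ) refl (fromNat k) ⟩
    1ℚ ℚ.+ fromNat k ℚ.- 1ℚ                      ≡⟨ cong (ℚ._- 1ℚ) (ι-+ (+ 1) (+ k)) ⟨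
    fromNat (suc k) ℚ.- 1ℚ                       ≤⟨ ℚ.+-monoˡ-≤ (ℚ.- 1ℚ) (fromNat-mono-≤ {suc k} {2 ℕ.* suc d} 1+k≤) ⟩
    fromNat (2 ℕ.* suc d) ℚ.- 1ℚ                 ≡⟨ cong (ℚ._- 1ℚ) (fromNat-* 2 (suc d)) ⟩
    fromNat 2 ℚ.* fromNat (suc d) ℚ.- 1ℚ         ≤⟨ ℚ.+-monoˡ-≤ (ℚ.- 1ℚ) (ℚ.*-monoˡ-≤-nonNeg (fromNat 2) d+1≤LB) ⟩
    fromNat 2 ℚ.* (L ℚ.* B) ℚ.- 1ℚ               ≡⟨ cong (ℚ._- 1ℚ) (ℚ.*-assoc (fromNat 2) L B) ⟨
    fromNat 2 ℚ.* L ℚ.* B ℚ.- 1ℚ                 ∎)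
    where
    open ℚ.≤-Reasoning
    open +-*-Solver
    1+k≤ : suc k ℕ.≤ 2 ℕ.* suc d
    1+k≤ = ℕ.≤-trans (ℕ.s≤s (ℕ.≤-trans k≤ (ℕ.+-mono-≤ (∣rep∣₁≤ H j {suc d} x rx) (ℕ.*-monoʳ-≤ 1 (∣rep∣₁≤ H j {d} y ry)))))
                     (ℕ.≤-reflexive (cong suc (sym (ℕ.+-suc d (d ℕ.+ 0)))))

-- The second norm bound, λ and the distance estimate

-- With m = 1 + t a, the given short representations of m h and a h produce norm at most L + t L,
-- and t a ≤ m ≤ LB bounds t by LB / a.
norm≤L[1+LB/a] : ∀ {q} (H : GapSequence q) (j : Fin (suc q)) {L B} → 1ℚ ℚ.≤ L → 1ℚ ℚ.≤ B →
  ∀ {m a} .{{_ : NonZero a}} → m % a ≡ 1 → m ℕ.* gap H j ∈ HasRep H j L B → a ℕ.* gap H j ∈ HasRep H j L B →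
  ∃[ k ] IntegerNorm H j k × fromNat k ℚ.≤ L ℚ.* (1ℚ ℚ.+ L ℚ.* B ℚ.* (+ 1 ℚ./ a))
norm≤L[1+LB/a] H j {L} {B} 1≤L 1≤B {m} {a} m≡1 rep@(x , rx , x≤L , _) (y , ry , y≤L , _)
  with norm-of-difference H j {m} {a} {m ℕ./ a} x y rx ry
         (trans (ℕ.m≡m%n+[m/n]*n m a) (cong (ℕ._+ m ℕ./ a ℕ.* a) m≡1))
... | k , k-norm , k≤ = k , k-norm , (begin
  fromNat k                                              ≤⟨ fromNat-mono-≤ {k} {sum x ℕ.+ t ℕ.* sum y} k≤ ⟩
  fromNat (sum x ℕ.+ t ℕ.* sum y)                        ≡⟨ trans (ι-+ (+ sum x) (+ (t ℕ.* sum y))) (cong (fromNat (sum x) ℚ.+_) (fromNat-* t (sum y))) ⟩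
  fromNat (sum x) ℚ.+ fromNat t ℚ.* fromNat (sum y)      ≤⟨ ℚ.+-mono-≤ x≤L (ℚ.*-monoˡ-≤-nonNeg (fromNat t) {{fromNat-nonNeg t}} y≤L) ⟩
  L ℚ.+ fromNat t ℚ.* L                                  ≤⟨ ℚ.+-monoʳ-≤ L (ℚ.*-monoʳ-≤-nonNeg L {{ℚ.nonNegative (ℚ.≤-trans (ℚ.nonNegative⁻¹ 1ℚ) 1≤L)}} t≤LB/a) ⟩
  L ℚ.+ L ℚ.* B ℚ.* 1/a ℚ.* L                            ≡⟨ solve 2 (λ l u → l :+ u :* l := l :* (con 1ℚ :+ u)) refl L (L ℚ.* B ℚ.* 1/a) ⟩
  L ℚ.* (1ℚ ℚ.+ L ℚ.* B ℚ.* 1/a)                         ∎)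
  where
  open ℚ.≤-Reasoning
  open +-*-Solver
  t = m ℕ./ a
  1/a = + 1 ℚ./ a
  t≤LB/a : fromNat t ℚ.≤ L ℚ.* B ℚ.* 1/a
  t≤LB/a = begin
    fromNat t                          ≡⟨ ℚ.*-identityʳ (fromNat t) ⟨
    fromNat t ℚ.* 1ℚ                   ≡⟨ cong (fromNat t ℚ.*_) (n*1/n≡1 a) ⟨
    fromNat t ℚ.* (fromNat a ℚ.* 1/a)  ≡⟨ ℚ.*-assoc (fromNat t) (fromNat a) 1/a ⟨
    fromNat t ℚ.* fromNat a ℚ.* 1/a    ≡⟨ cong (ℚ._* 1/a) (fromNat-* t a) ⟨
    fromNat (t ℕ.* a) ℚ.* 1/a          ≤⟨ ℚ.*-monoʳ-≤-nonNeg 1/a {{ℚ.normalize-nonNeg 1 a}}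
                                            (ℚ.≤-trans (fromNat-mono-≤ {t ℕ.* a} {m} (ℕ.m/n*n≤m m a)) (multiplier≤LB H j 1≤B m rep)) ⟩
    L ℚ.* B ℚ.* 1/a                    ∎

-- Two vectors, one for each entry of the minimum, bound the same λ; the first also shows that λ is
-- finite.
λ≤bound : ∀ {q} (H : GapSequence q) (j : Fin (suc q)) L B a .{{_ : NonZero a}} →
  ∃[ k ] IntegerNorm H j k × fromNat k ℚ.≤ fromNat 2 ℚ.* L ℚ.* B ℚ.- 1ℚ →
  ∃[ k ] IntegerNorm H j k × fromNat k ℚ.≤ L ℚ.* (1ℚ ℚ.+ L ℚ.* B ℚ.* (+ 1 ℚ./ a)) →
  ∃[ l ] IsLambda H j [ l ] × fromNat l ℚ.≤ bound L B a
λ≤bound H j L B a (k₁ , norm₁ , k₁≤) (k₂ , norm₂ , k₂≤) =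
  let l , l-norm , l-min = least (IntegerNorm? H j) norm₁
  in l , (l-norm , l-min) , ℚ.⊓-glb
       (ℚ.≤-trans (fromNat-mono-≤ {l} {k₁} (l-min k₁ norm₁)) k₁≤)
       (ℚ.≤-trans (fromNat-mono-≤ {l} {k₂} (l-min k₂ norm₂)) k₂≤)

-- Multiplying an integer representation of h by k / n expresses k h / n through the numbers k h_i /
-- n, each within `δ` of an integer.
‖kh/n‖≤lδ : ∀ {q} (H : GapSequence q) (j : Fin (suc q)) n .{{_ : NonZero n}} k {l} → IntegerNorm H j l →
  ‖ + (k ℕ.* gap H j) ℚ./ n ‖ₜ ℚ.≤ fromNat l ℚ.* δ n H j k
‖kh/n‖≤lδ H j n k {l} (x , eq , norm) = begin
  ‖ + (k ℕ.* gap H j) ℚ./ n ‖ₜ                                    ≡⟨ cong ‖_‖ₜ (scaled (gap H j)) ⟨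
  ‖ fromNat (gap H j) ℚ.* k/n ‖ₜ                                  ≡⟨ cong (λ z → ‖ ι z ℚ.* k/n ‖ₜ) eq ⟨
  ‖ ι (sumℤ (λ i → x i ℤ.* + earlier H j i)) ℚ.* k/n ‖ₜ           ≤⟨ ‖Σxg‖≤∣x∣₁D x (earlier H j) k/n (δ n H j k) ‖gk/n‖≤δ ⟩
  fromNat (sum (ℤ.∣_∣ ∘ x)) ℚ.* δ n H j k                         ≡⟨ cong (λ m → fromNat m ℚ.* δ n H j k) norm ⟩
  fromNat l ℚ.* δ n H j k                                         ∎
  where
  open ℚ.≤-Reasoning
  open +-*-Solver
  k/n = fromNat k ℚ.* (+ 1 ℚ./ n)
  scaled : ∀ g → fromNat g ℚ.* k/n ≡ + (k ℕ.* g) ℚ./ n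
  scaled g = begin-equality
    fromNat g ℚ.* (fromNat k ℚ.* (+ 1 ℚ./ n)) ≡⟨ solve 3 (λ g k u → g :* (k :* u) := k :* g :* u) refl (fromNat g) (fromNat k) (+ 1 ℚ./ n) ⟩
    fromNat k ℚ.* fromNat g ℚ.* (+ 1 ℚ./ n)   ≡⟨ cong (ℚ._* (+ 1 ℚ./ n)) (fromNat-* k g) ⟨
    fromNat (k ℕ.* g) ℚ.* (+ 1 ℚ./ n)         ≡⟨ /-as-* (+ (k ℕ.* g)) n ⟨
    + (k ℕ.* g) ℚ./ n                         ∎
  ‖gk/n‖≤δ : ∀ i → ‖ fromNat (earlier H j i) ℚ.* k/n ‖ₜ ℚ.≤ δ n H j k
  ‖gk/n‖≤δ i = begin
    ‖ fromNat (earlier H j i) ℚ.* k/n ‖ₜ      ≡⟨ cong ‖_‖ₜ (scaled (earlier H j i)) ⟩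
    ‖ + (k ℕ.* earlier H j i) ℚ./ n ‖ₜ        ≤⟨ entry≤max (λ i → ‖ + (k ℕ.* earlier H j i) ℚ./ n ‖ₜ) i ⟩
    δ n H j k                                 ∎

theoremE7 : (n : ℕ) .{{_ : NonZero n}} → 2 ℕ.≤ n →
    (q : ℕ) (H : GapSequence q) (j : Fin (suc q)) → 2 ℕ.≤ suc (toℕ j) →
    (L B : ℚ) → 1ℚ ℚ.≤ L → 1ℚ ℚ.≤ B →
    (a : ℕ) .{{_ : NonZero a}} → 2 ℕ.≤ a →
    a ∈ Q H j → a ℕ.* gap H j ∈ HasRep H j L B →
    (w : ℕ → ℕ) → w 0 ≡ 0 →
    (∀ r → r ℕ.< a → w r ∈ Q H j × w r % a ≡ r % a × w r ℕ.* gap H j ∈ HasRep H j L B) →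
    IsNumericalSemigroup (Q H j)
    × (∃[ c ] HasConductor (Q H j) c × fromNat c ℚ.≤ L ℚ.* B)
    × (∃[ γ ] ∃[ g ] HasTruncatedGenus H j n γ × HasGenus (Q H j) g × γ ℕ.≤ g × fromNat g ℚ.< L ℚ.* B)
    × (∃[ l ] IsLambda H j l × l ≤⁺ bound L B a)
    × (∀ k → 1 ℕ.≤ k → k ℕ.< n →
    ‖ + (k ℕ.* gap H j) ℚ./ n ‖ₜ ℚ.≤ bound L B a ℚ.* δ n H j k)
theoremE7 n _ q H j _ L B 1≤L 1≤B a 2≤a a∈Q a-rep w _ w-rep =
  let d , d+1≤LB , Q≥d = Q-eventually-all H j 1≤B 2≤a a∈Q a-rep w w-rep
      open EventuallyAll H j L B {d} d+1≤LB Q≥d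
      -- `2≤a` is also the proof of 1 < a, so residue 1 is available and w 1 ≡ 1 modulo a.
      _ , w₁≡1 , w₁-rep = w-rep 1 2≤a
      l , l-min , l≤bound = λ≤bound H j L B a
        norm≤2LB-1
        (norm≤L[1+LB/a] H j 1≤L 1≤B {w 1} {a} (trans w₁≡1 (ℕ.m<n⇒m%n≡m 2≤a)) w₁-rep a-rep)
  in isNumericalSemigroup , conductor , genera n , ([ l ] , l-min , l≤bound) , λ k _ _ →
     ℚ.≤-trans (‖kh/n‖≤lδ H j n k (proj₁ l-min))
       -- Multiplying the bound on λ by `δ` keeps its direction because `δ` is a maximum started at
       -- 0.
       (ℚ.*-monoʳ-≤-nonNeg (δ n H j k)
         {{ℚ.nonNegative (0≤max (λ i → ‖ + (k ℕ.* earlier H j i) ℚ./ n ‖ₜ))}} l≤bound)
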